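{- $\mathsf{D}_0(C_2^4)=5$ and $k_{\mathsf{D}}(C_2^4)=3$. Additionally, $\mathsf{D}_{1}(C_2^4)=5$ and $\mathsf{D}_{2}(C_2^4)=8$.
   Context: $C_2^4$ is the elementary abelian $2$-group of rank $4$. A sequence over a finite abelian group $G$ is a finite unordered list of elements with repetitions; zero-sum means its terms sum to $0$. $\mathsf{D}_k(G)$ ($k\in\mathbb{N}$) is the smallest $\ell$ such that every sequence over $G$ of length at least $\ell$ has $k$ disjoint non-empty zero-sum subsequences. It is known that there exists $\mathsf{D}_0(G)\in\mathbb{N}_0$ with $\mathsf{D}_k(G)=\mathsf{D}_0(G)+k\exp(G)$ for all sufficiently large $k$; $k_{\mathsf{D}}(G)$ is the minimal $k_0\in\mathbb{N}$ with $\mathsf{D}_k(G)=\mathsf{D}_0(G)+k\exp(G)$ for all $k\ge k_0$. -}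

module Defs where

open import Level using (Level; 0ℓ; _⊔_)
open import Algebra.Bundles using (AbelianGroup)
import Algebra.Construct.DirectProduct as DirectProduct
import Algebra.Definitions.RawMonoid as RawMonoidDefinitions
open import Data.List using (List; []; _++_; concat; foldr; length)
open import Data.List.Relation.Unary.All using (All)
import Data.List.Relation.Binary.Permutation.Setoid as Permutation
open import Data.Nat using (ℕ; _+_; _*_; _≤_; _≥_)
open import Data.Nat.Properties using (≤-antisym)
import Data.Parity.Properties as Parity
open import Data.Product using (_×_; _,_; ∃-syntax)
open import Relation.Binary.PropositionalEquality using (_≡_; _≢_)

private
  variable
    p : Level

Least : (ℕ → Set p) → ℕ → Set p
Least P n = P n × (∀ m → P m → n ≤ m)

Least-unique : {P : ℕ → Set p} {m n : ℕ} → Least P m → Least P n → m ≡ n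
Least-unique (Pm , m≤) (Pn , n≤) = ≤-antisym (m≤ _ Pn) (n≤ _ Pm)

-- The invariants are given by their graphs: IsD k l, IsD₀ d and IsK-D κ mean
-- D_k(G) = l, D_0(G) = d and k_D(G) = κ, including that the value exists.
module Davenport {c e : Level} (G : AbelianGroup c e) where

  open AbelianGroup G using (Carrier; _≈_; _∙_; ε; setoid; rawMonoid)
  open Permutation setoid using (_↭_)
  open RawMonoidDefinitions rawMonoid using () renaming (_×_ to _·_)

  -- Sequences are unordered: a list stands for its class under _↭_.
  Sequence : Set c
  Sequence = List Carrier

  σ : Sequence → Carrier
  σ = foldr _∙_ ε

  ZeroSum : Sequence → Set e
  ZeroSum T = σ T ≈ ε

  -- Subsequences T₁, …, T_k of S are disjoint when their product T₁ ⋯ T_k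
  -- divides S, that is, T₁ ⋯ T_k R = S for some sequence R.
  HasDisjointZeroSums : ℕ → Sequence → Set (c ⊔ e)
  HasDisjointZeroSums k S =
    ∃[ Ts ] (length Ts ≡ k
           × All (λ T → T ≢ [] × ZeroSum T) Ts
           × ∃[ R ] (concat Ts ++ R ↭ S))

  IsD : ℕ → ℕ → Set (c ⊔ e)
  IsD k = Least λ l → (S : Sequence) → length S ≥ l → HasDisjointZeroSums k S

  IsExponent : ℕ → Set (c ⊔ e)
  IsExponent = Least λ n → n ≥ 1 × ((g : Carrier) → n · g ≈ ε)

  -- k₀ is positive, and D_k(G) = d + k exp(G) for all k ≥ k₀.
  LinearFrom : ℕ → ℕ → Set (c ⊔ e)
  LinearFrom d k₀ =
    k₀ ≥ 1 × ∃[ n ] (IsExponent n × (∀ k → k ≥ k₀ → IsD k (d + k * n)))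

  IsD₀ : ℕ → Set (c ⊔ e)
  IsD₀ d = ∃[ k₀ ] LinearFrom d k₀

  IsK-D : ℕ → Set (c ⊔ e)
  IsK-D κ = ∃[ d ] (IsD₀ d × Least (LinearFrom d) κ)

C₂ : AbelianGroup 0ℓ 0ℓ
C₂ = Parity.+-0-abelianGroup

C₂⁴ : AbelianGroup 0ℓ 0ℓ
C₂⁴ = C₂ ⊗ (C₂ ⊗ (C₂ ⊗ C₂))
  where _⊗_ = DirectProduct.abelianGroup

{-# OPTIONS --safe #-}
module Submission where

-- Lower bounds. Give elements with last coordinate 1 weight 1 and all others
-- weight 2. In a sequence of nonzero elements whose weight-1 terms are distinct,
-- every nonempty zero-sum subsequence has weight at least 4, so a sequence of
-- weight at most 4k with nonzero sum has no k disjoint ones. This applies to an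
-- affine basis (k = 1), to seven of the eight weight-1 elements (k = 2), and to
-- all eight of them together with h′ and an odd power of h (k ≥ 3).
--
-- Upper bounds. For k = 1, a sequence without zero-sum subsequence has 2^|S|
-- distinct subsums. For larger k, a zero or a repeated term gives a zero-sum
-- subsequence of length at most 2 and one inducts; otherwise S is a set of
-- nonzero elements, i.e. of points of PG(3,2). Eight points contain a line or
-- are the complement of a plane; eleven contain a line; thirteen contain four
-- lines of a spread, because any two points lie on a line of one of the seven
-- spreads of a packing; fifteen are all points and are partitioned by a spread.

open import Defs
open import Algebra.Bundles using (AbelianGroup)
open import Data.Bool using (Bool; true; false; T)
open import Data.Bool.ListAction using (all)
open import Data.List using (List; []; _∷_; [_]; _++_; concat; map; length; filter; take; drop; cartesianProduct; concatMap; iterate)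
open import Data.List.Membership.Propositional using (_∈_; _∉_; find)
open import Data.List.Membership.Propositional.Properties using (∈-∃++; ∈-map⁺; ∈-map⁻; ∈-++⁺ˡ; ∈-++⁺ʳ; ∈-++⁻; ∈-cartesianProduct⁺; ∈-filter⁻)
import Data.List.Membership.DecPropositional as DecMembership
open import Data.List.Properties using (length-++; length-map; map-++; ++-assoc; ++-identityʳ) renaming (≡-dec to List-≡-dec)
import Data.List.Relation.Binary.Permutation.Homogeneous as Homogeneous
open import Data.List.Relation.Binary.Permutation.Propositional using (_↭_; ↭-refl; ↭-sym; ↭-trans; ↭-reflexive; ↭-prep; ↭⇒↭ₛ; ↭⇒↭ₛ′; ↭ₛ⇒↭)
open import Data.List.Relation.Binary.Permutation.Propositional.Properties using (shift; ++⁺ˡ; ↭-length; All-resp-↭; ∈-resp-↭) renaming (map⁺ to ↭-map⁺)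
import Data.List.Relation.Binary.Permutation.Setoid as SetoidPermutation
import Data.List.Relation.Binary.Permutation.Setoid.Properties as SetoidPermutationProperties
open import Data.List.Relation.Unary.All as All using (All; []; _∷_)
import Data.List.Relation.Unary.All.Properties as All
open import Data.List.Relation.Unary.AllPairs using (AllPairs; []; _∷_; allPairs?)
open import Data.List.Relation.Unary.Any using (here; there)
open import Data.List.Relation.Unary.Unique.Propositional using (Unique)
import Data.List.Relation.Unary.Unique.Propositional.Properties as Unique
import Data.List.Relation.Unary.Unique.DecPropositional as DecUnique
open import Data.Nat using (ℕ; zero; suc; _+_; _*_; _^_; _≤_; _≥_; _>_; z≤n; s≤s; _≤?_)
open import Data.Nat.ListAction using (sum)
open import Data.Nat.ListAction.Properties using (sum-++; sum-↭)
open import Data.Nat.Properties using (≤-trans; ≤-refl; ≤-reflexive; <⇒≱; ≰⇒>; m≤m+n; +-mono-≤; +-monoʳ-≤; +-monoˡ-≤; +-cancelˡ-≤; +-suc; +-identityʳ; ^-monoʳ-≤; n≤1+n; module ≤-Reasoning) renaming (_≟_ to _≟ℕ_)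
open import Data.Parity using (Parity; 0ℙ; 1ℙ) renaming (_+_ to _+ℙ_; _*_ to _*ℙ_)
import Data.Parity.Properties as Parity
open import Data.Product using (_×_; _,_; proj₁; proj₂; ∃-syntax)
open import Data.Product.Properties using (≡-dec)
open import Data.Sum using (_⊎_; inj₁; inj₂; [_,_]′)
open import Data.Unit using (tt)
open import Function using (_∘_)
open import Relation.Binary.Definitions using (DecidableEquality)
open import Relation.Binary.PropositionalEquality using (_≡_; _≢_; refl; sym; trans; cong; cong₂; subst; resp₂; module ≡-Reasoning)
import Relation.Binary.PropositionalEquality as ≡
open import Relation.Nullary using (¬_; Dec; yes; no; contradiction; ¬?; _×-dec_)
open import Relation.Nullary.Decidable as Dec using (toWitness; from-yes)

-- Lists

module _ {a} {A : Set a} where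

  ∈-delete : ∀ {x y : A} as {bs} → x ≢ y × y ∈ as ++ x ∷ bs → y ∈ as ++ bs
  ∈-delete as {bs} (x≢y , y∈) with ∈-resp-↭ (shift _ as bs) y∈
  ... | here y≡x  = contradiction (sym y≡x) x≢y
  ... | there y∈′ = y∈′

  -- Membership is what the search below yields, while disjointness of subsequences is stated by
  -- permutations.
  Unique-⊆⇒↭ : {xs ys : List A} → Unique xs → All (_∈ ys) xs →
               ∃[ R ] (xs ++ R ↭ ys)
  Unique-⊆⇒↭ {ys = ys} [] [] = ys , ↭-refl
  Unique-⊆⇒↭ {x ∷ xs} (x≢ ∷ u) (x∈ys ∷ xs⊆ys)
    with as , bs , refl ← ∈-∃++ x∈ys
    with R , p ← Unique-⊆⇒↭ u (All.zipWith (∈-delete as) (x≢ , xs⊆ys))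
    = R , ↭-trans (↭-prep x p) (↭-sym (shift x as bs))

  Unique⇒length≤ : {xs ys : List A} → Unique xs → (∀ x → x ∈ ys) →
                      length xs ≤ length ys
  Unique⇒length≤ {xs} u complete
    with R , p ← Unique-⊆⇒↭ u (All.universal complete xs) =
    ≤-trans (m≤m+n (length xs) (length R))
      (≤-reflexive (trans (sym (length-++ xs)) (↭-length p)))

  AllPairs-++⁻ : ∀ {r} {R : A → A → Set r} xs {ys} → AllPairs R (xs ++ ys) →
                 AllPairs R xs × AllPairs R ys
  AllPairs-++⁻ []       rs       = [] , rs
  AllPairs-++⁻ (x ∷ xs) (r ∷ rs) with rxs , rys ← AllPairs-++⁻ xs rs =
    All.++⁻ˡ xs r ∷ rxs , rys

  All-∉-∷ : ∀ {x : A} {C g} → x ∉ g × All (_∉ C) g → All (_∉ x ∷ C) g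
  All-∉-∷ (x∉g , g∉C) = All.zipWith
    (λ { (x≢y , y∉C) (here y≡x)  → x≢y (sym y≡x)
       ; (x≢y , y∉C) (there y∈C) → y∉C y∈C })
    (All.¬Any⇒All¬ _ x∉g , g∉C)

  leaveOneOut : List A → List (List A)
  leaveOneOut []       = []
  leaveOneOut (x ∷ xs) = xs ∷ map (x ∷_) (leaveOneOut xs)

module HittingSet {a} {A : Set a} (_≟_ : DecidableEquality A) where

  open DecMembership _≟_ using (_∈?_; _∉?_)

  -- covers n F certifies that no set of fewer than n elements meets every
  -- member of F: a hitting set must contain an element of the first member,
  -- and then it remains to meet the members not containing that element.
  covers : ℕ → List (List A) → Bool
  covers zero    _       = true
  covers (suc n) []      = false
  covers (suc n) (f ∷ F) = all (λ x → covers n (filter (x ∉?_) F)) f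

  -- `C` collects elements outside `S`. If the first member is not contained in `S`, some `x` of it
  -- lies outside `S`, and outside `C` because the remaining members avoid `C`; moving `x` into `C`
  -- spends one unit of `n`. At `n` = 0 the list `C ++ S` would be longer than any duplicate-free
  -- list.
  covers-sound : ∀ {N} → (∀ {xs : List A} → Unique xs → length xs ≤ N) →
                 ∀ n F {S} C → T (covers n F) →
                 Unique (C ++ S) → All (All (_∉ C)) F → n + length (C ++ S) > N →
                 ∃[ f ] (f ∈ F × All (_∈ S) f)
  covers-sound bound zero    F C _ u _ big = contradiction (bound u) (<⇒≱ big)
  covers-sound {N} bound (suc n) (f ∷ F) {S} C ok u (f∉C ∷ F∉C) big
    with All.all? (_∈? S) f
  ... | yes f⊆S = f , here refl , f⊆S
  ... | no f⊈S
    with x , x∈f , x∉S ← find (All.¬All⇒Any¬ (_∈? S) f f⊈S)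
    with g , g∈ , g⊆S ← covers-sound bound n (filter (x ∉?_) F) (x ∷ C)
           (All.lookup (All.all⁺ _ f ok) x∈f)
           (All.¬Any⇒All¬ _ ([ All.lookup f∉C x∈f , x∉S ]′ ∘ ∈-++⁻ C) ∷ u)
           (All.zipWith All-∉-∷ (All.all-filter (x ∉?_) F , All.filter⁺ (x ∉?_) F∉C))
           (subst (_> N) (sym (+-suc n _)) big)
    = g , there (proj₁ (∈-filter⁻ (x ∉?_) g∈)) , g⊆S

-- The group C₂⁴

open AbelianGroup C₂⁴ using (_≈_; _∙_; ε; isEquivalence; isCommutativeMonoid; setoid; assoc; comm; identityʳ; identityˡ) renaming (Carrier to V)
open Davenport C₂⁴
open SetoidPermutation setoid using () renaming (_↭_ to _↭≈_)

≈⇒≡ : ∀ {x y} → x ≈ y → x ≡ y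
≈⇒≡ (refl , refl , refl , refl) = refl

≡⇒≈ : ∀ {x y} → x ≡ y → x ≈ y
≡⇒≈ refl = refl , refl , refl , refl

↭≈⇒↭ : ∀ {xs ys} → xs ↭≈ ys → xs ↭ ys
↭≈⇒↭ = ↭ₛ⇒↭ ∘ Homogeneous.map ≈⇒≡

↭⇒↭≈ : ∀ {xs ys} → xs ↭ ys → xs ↭≈ ys
↭⇒↭≈ = ↭⇒↭ₛ′ isEquivalence

σ-↭ : ∀ {xs ys} → xs ↭ ys → σ xs ≡ σ ys
σ-↭ = ≈⇒≡ ∘ SetoidPermutationProperties.foldr-commMonoid setoid isCommutativeMonoid ∘ ↭⇒↭≈

∙-self : ∀ x → x ∙ x ≡ ε
∙-self (a , b , c , d) =
  ≈⇒≡ (Parity.p+p≡0ℙ a , Parity.p+p≡0ℙ b , Parity.p+p≡0ℙ c , Parity.p+p≡0ℙ d)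

∙-assoc : ∀ x y z → (x ∙ y) ∙ z ≡ x ∙ (y ∙ z)
∙-assoc x y z = ≈⇒≡ (assoc x y z)

∙-comm : ∀ x y → x ∙ y ≡ y ∙ x
∙-comm x y = ≈⇒≡ (comm x y)

∙-cancel : ∀ x y → x ∙ (x ∙ y) ≡ y
∙-cancel x y = trans (sym (∙-assoc x x y))
  (trans (cong (_∙ y) (∙-self x)) (≈⇒≡ (identityˡ y)))

∙-injective : ∀ x {y z} → x ∙ y ≡ x ∙ z → y ≡ z
∙-injective x {y} {z} eq =
  trans (sym (∙-cancel x y)) (trans (cong (x ∙_) eq) (∙-cancel x z))

σ-++ : ∀ xs ys → σ (xs ++ ys) ≡ σ xs ∙ σ ys
σ-++ []       ys = sym (≈⇒≡ (identityˡ (σ ys)))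
σ-++ (x ∷ xs) ys = trans (cong (x ∙_) (σ-++ xs ys)) (sym (∙-assoc x (σ xs) (σ ys)))

_≟_ : DecidableEquality V
_≟_ = ≡-dec Parity._≟_ (≡-dec Parity._≟_ (≡-dec Parity._≟_ Parity._≟_))

open DecMembership _≟_ using (_∈?_; _∉?_)
open DecUnique _≟_ using (unique?)
open HittingSet _≟_

parities : List Parity
parities = 0ℙ ∷ 1ℙ ∷ []

∈-parities : ∀ p → p ∈ parities
∈-parities 0ℙ = here refl
∈-parities 1ℙ = there (here refl)

elements : List V
elements = cartesianProduct parities (cartesianProduct parities (cartesianProduct parities parities))

∈-elements : ∀ x → x ∈ elements
∈-elements (a , b , c , d) =
  ∈-cartesianProduct⁺ (∈-parities a) (∈-cartesianProduct⁺ (∈-parities b)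
    (∈-cartesianProduct⁺ (∈-parities c) (∈-parities d)))

Unique⇒length≤16 : {xs : List V} → Unique xs → length xs ≤ 16
Unique⇒length≤16 u = Unique⇒length≤ u ∈-elements

-- Disjoint zero-sum subsequences

NonemptyZeroSum : Sequence → Set
NonemptyZeroSum T = T ≢ [] × ZeroSum T

nonemptyZeroSum? : ∀ T → Dec (NonemptyZeroSum T)
nonemptyZeroSum? T = ¬? (List-≡-dec _≟_ T []) ×-dec Dec.map′ ≡⇒≈ ≈⇒≡ (σ T ≟ ε)

none : ∀ S → HasDisjointZeroSums 0 S
none S = [] , refl , [] , S , ↭⇒↭≈ ↭-refl

adjoin : ∀ {k T R S} → NonemptyZeroSum T → T ++ R ↭ S →
         HasDisjointZeroSums k R → HasDisjointZeroSums (suc k) S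
adjoin {T = T} zs p (Ts , len , zss , R′ , q) =
  T ∷ Ts , cong suc len , zs ∷ zss , R′ ,
  ↭⇒↭≈ (↭-trans (↭-reflexive (++-assoc T (concat Ts) R′))
    (↭-trans (++⁺ˡ T (↭≈⇒↭ q)) p))

adjoins : ∀ {k} Ts {R S} → All NonemptyZeroSum Ts → concat Ts ++ R ↭ S →
          HasDisjointZeroSums k R → HasDisjointZeroSums (length Ts + k) S
adjoins []       []         p (Us , len , zss , R′ , q) =
  Us , len , zss , R′ , ↭⇒↭≈ (↭-trans (↭≈⇒↭ q) p)
adjoins (T ∷ Ts) {R} (zs ∷ zss) p has =
  adjoin zs (↭-trans (↭-reflexive (sym (++-assoc T (concat Ts) R))) p)
    (adjoins Ts zss ↭-refl has)

weaken : ∀ {k} x {S} → HasDisjointZeroSums k S → HasDisjointZeroSums k (x ∷ S)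
weaken x (Ts , len , zss , R , p) =
  Ts , len , zss , x ∷ R ,
  ↭⇒↭≈ (↭-trans (shift x (concat Ts) R) (↭-prep x (↭≈⇒↭ p)))

Upper : ℕ → ℕ → Set
Upper k n = ∀ S → length S ≥ n → HasDisjointZeroSums k S

-- The bound for k = 1

subsums : Sequence → List V
subsums []      = [ ε ]
subsums (x ∷ S) = subsums S ++ map (x ∙_) (subsums S)

length-subsums : ∀ S → length (subsums S) ≡ 2 ^ length S
length-subsums []      = refl
length-subsums (x ∷ S) = begin
  length (subsums S ++ map (x ∙_) (subsums S))
    ≡⟨ length-++ (subsums S) ⟩
  length (subsums S) + length (map (x ∙_) (subsums S))
    ≡⟨ cong (length (subsums S) +_) (length-map (x ∙_) (subsums S)) ⟩
  length (subsums S) + length (subsums S)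
    ≡⟨ cong₂ _+_ (length-subsums S) (length-subsums S) ⟩
  2 ^ length S + 2 ^ length S
    ≡⟨ cong (2 ^ length S +_) (sym (+-identityʳ _)) ⟩
  2 ^ length (x ∷ S) ∎
  where open ≡-Reasoning

∈-subsums⁻ : ∀ S {a} → a ∈ subsums S → ∃[ A ] ∃[ R ] (σ A ≡ a × A ++ R ↭ S)
∈-subsums⁻ [] (here refl) = [] , [] , refl , ↭-refl
∈-subsums⁻ (x ∷ S) a∈ with ∈-++⁻ (subsums S) a∈
... | inj₁ a∈S with A , R , eq , p ← ∈-subsums⁻ S a∈S =
  A , x ∷ R , eq , ↭-trans (shift x A R) (↭-prep x p)
... | inj₂ a∈xS with b , b∈S , refl ← ∈-map⁻ (x ∙_) a∈xS
               with A , R , refl , p ← ∈-subsums⁻ S b∈S =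
  x ∷ A , R , refl , ↭-prep x p

-- In exponent 2 the subsums form a subgroup, as a term used on both sides cancels.
∙-∈-subsums : ∀ S {a b} → a ∈ subsums S → b ∈ subsums S → a ∙ b ∈ subsums S
∙-∈-subsums [] (here refl) (here refl) = here refl
∙-∈-subsums (x ∷ S) {a} {b} a∈ b∈ with ∈-++⁻ (subsums S) a∈ | ∈-++⁻ (subsums S) b∈
... | inj₁ a∈S | inj₁ b∈S = ∈-++⁺ˡ (∙-∈-subsums S a∈S b∈S)
... | inj₁ a∈S | inj₂ b∈xS with c , c∈S , refl ← ∈-map⁻ (x ∙_) b∈xS =
  ∈-++⁺ʳ (subsums S) (subst (_∈ map (x ∙_) (subsums S))
    (trans (sym (∙-assoc x a c)) (trans (cong (_∙ c) (∙-comm x a)) (∙-assoc a x c)))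
    (∈-map⁺ (x ∙_) (∙-∈-subsums S a∈S c∈S)))
... | inj₂ a∈xS | inj₁ b∈S with c , c∈S , refl ← ∈-map⁻ (x ∙_) a∈xS =
  ∈-++⁺ʳ (subsums S) (subst (_∈ map (x ∙_) (subsums S))
    (sym (∙-assoc x c b)) (∈-map⁺ (x ∙_) (∙-∈-subsums S c∈S b∈S)))
... | inj₂ a∈xS | inj₂ b∈xS with c , c∈S , refl ← ∈-map⁻ (x ∙_) a∈xS
                            with d , d∈S , refl ← ∈-map⁻ (x ∙_) b∈xS =
  ∈-++⁺ˡ (subst (_∈ subsums S) (sym (begin
    (x ∙ c) ∙ (x ∙ d) ≡⟨ cong (_∙ (x ∙ d)) (∙-comm x c) ⟩
    (c ∙ x) ∙ (x ∙ d) ≡⟨ ∙-assoc c x (x ∙ d) ⟩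
    c ∙ (x ∙ (x ∙ d)) ≡⟨ cong (c ∙_) (∙-cancel x d) ⟩
    c ∙ d ∎)) (∙-∈-subsums S c∈S d∈S))
  where open ≡-Reasoning

-- If `x` is a subsum of the rest, it completes that subsum to a zero-sum subsequence. Otherwise the
-- subsums that use `x` form a coset disjoint from the subgroup of subsums of `S`.
zeroSum⊎unique-subsums : ∀ S → HasDisjointZeroSums 1 S ⊎ Unique (subsums S)
zeroSum⊎unique-subsums [] = inj₂ ([] ∷ [])
zeroSum⊎unique-subsums (x ∷ S) with zeroSum⊎unique-subsums S | x ∈? subsums S
... | inj₁ has | _ = inj₁ (weaken x has)
... | inj₂ _   | yes x∈ with A , R , refl , p ← ∈-subsums⁻ S x∈ =
  inj₁ (adjoin {T = x ∷ A} ((λ ()) , ≡⇒≈ (∙-self x)) (↭-prep x p) (none R))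
... | inj₂ u   | no x∉ =
  inj₂ (Unique.++⁺ u (Unique.map⁺ (∙-injective x) u) disjoint)
  where
  disjoint : ∀ {v} → ¬ (v ∈ subsums S × v ∈ map (x ∙_) (subsums S))
  disjoint (v∈S , v∈xS) with b , b∈S , refl ← ∈-map⁻ (x ∙_) v∈xS =
    x∉ (subst (_∈ subsums S)
      (trans (cong (b ∙_) (∙-comm x b)) (∙-cancel b x))
      (∙-∈-subsums S b∈S v∈S))

upper₁ : Upper 1 5
upper₁ S |S|≥5 with zeroSum⊎unique-subsums S
... | inj₁ has = has
... | inj₂ u   = contradiction
  (≤-trans (^-monoʳ-≤ 2 |S|≥5)
    (≤-trans (≤-reflexive (sym (length-subsums S))) (Unique⇒length≤16 u)))
  (<⇒≱ (toWitness {a? = 17 ≤? 32} tt))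

-- The bounds for k ≥ 2

-- Since `g ∙ g` is zero, a zero or a repeated term gives the short subsequence. `Unique (ε ∷ S)`
-- expresses both distinctness and the absence of zero.
short⊎unique : ∀ S → (∃[ T ] ∃[ R ] (NonemptyZeroSum T × length T ≤ 2 × T ++ R ↭ S))
                   ⊎ Unique (ε ∷ S)
short⊎unique [] = inj₂ ([] ∷ [])
short⊎unique (x ∷ S) with short⊎unique S | x ∈? (ε ∷ S)
... | inj₁ (T , R , zs , short , p) | _ =
  inj₁ (T , x ∷ R , zs , short , ↭-trans (shift x T R) (↭-prep x p))
... | inj₂ _ | yes (here refl) =
  inj₁ ([ ε ] , S , ((λ ()) , ≡⇒≈ refl) , s≤s z≤n , ↭-refl)
... | inj₂ _ | yes (there x∈S) with as , bs , refl ← ∈-∃++ x∈S =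
  inj₁ (x ∷ x ∷ [] , as ++ bs ,
    ((λ ()) , ≡⇒≈ (trans (cong (x ∙_) (≈⇒≡ (identityʳ x))) (∙-self x))) ,
    ≤-refl , ↭-prep x (↭-sym (shift x as bs)))
... | inj₂ (ε≢ ∷ u) | no x∉ =
  inj₂ (((x∉ ∘ here ∘ sym) ∷ ε≢) ∷ All.¬Any⇒All¬ S (x∉ ∘ there) ∷ u)

remainder-length : ∀ T {R S : Sequence} {m b n} → T ++ R ↭ S → length T ≤ m →
                   m + b ≤ n → n ≤ length S → b ≤ length R
remainder-length T {R} {S} {m} {b} {n} p |T|≤m m+b≤n n≤|S| =
  +-cancelˡ-≤ m b (length R) (begin
    m + b               ≤⟨ m+b≤n ⟩
    n                   ≤⟨ n≤|S| ⟩
    length S            ≡⟨ ↭-length p ⟨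
    length (T ++ R)     ≡⟨ length-++ T ⟩
    length T + length R ≤⟨ +-monoˡ-≤ (length R) |T|≤m ⟩
    m + length R        ∎)
  where open ≤-Reasoning

-- Splitting off a zero-sum subsequence of length at most 2 leaves at least `n` terms, so only sets
-- of nonzero elements call for a separate argument.
upper-suc : ∀ {k n} → Upper k n →
            (∀ S → length S ≥ 2 + n → Unique (ε ∷ S) → HasDisjointZeroSums (suc k) S) →
            Upper (suc k) (2 + n)
upper-suc upper simple S |S|≥ with short⊎unique S
... | inj₂ u = simple S |S|≥ u
... | inj₁ (T , R , zs , short , p) =
  adjoin zs p (upper R (remainder-length T p short ≤-refl |S|≥))

-- `Unique (concat P)` makes the members sets and pairwise disjoint at once. Avoiding `[ ε ]` is
-- phrased to match the initial value of `C` in `covers-sound`.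
Packing : List Sequence → Set
Packing P = All NonemptyZeroSum P × Unique (concat P) × All (_∉ [ ε ]) (concat P)

packing? : ∀ P → Dec (Packing P)
packing? P = All.all? nonemptyZeroSum? P ×-dec unique? (concat P) ×-dec All.all? (_∉? [ ε ]) (concat P)

-- Fewer than `n` of the 16 elements lie outside `ε ∷ S`, too few to meet every packing in `Ps`. The
-- search starts with zero already excluded.
find-packing : ∀ n Ps → T (covers n (map concat Ps)) → All Packing Ps →
               ∀ {S} → n + length (ε ∷ S) > 16 → Unique (ε ∷ S) →
               ∃[ P ] ∃[ R ] (P ∈ Ps × concat P ++ R ↭ S)
find-packing n Ps ok packings {S} big u
  with f , f∈ , f⊆S ← covers-sound Unique⇒length≤16 n (map concat Ps) [ ε ] ok u
                        (All.map⁺ (All.map (proj₂ ∘ proj₂) packings)) big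
  with P , P∈ , refl ← ∈-map⁻ concat f∈
  with R , p ← Unique-⊆⇒↭ (proj₁ (proj₂ (All.lookup packings P∈))) f⊆S
  = P , R , P∈ , p

-- Lines, spreads and affine planes

line : V → V → Sequence
line x y = x ∷ y ∷ x ∙ y ∷ []

-- Writing C₂⁴ = 𝔽₈ ⊕ 𝔽₂ with 𝔽₈ = 𝔽₂[α], α³ = α + 1, this is
-- multiplication by α on the first summand.
rotate : V → V
rotate (a , b , c , d) = c , a +ℙ c , b , d

-- Five pairwise disjoint lines of three points each, hence a partition of the 15 points.
spread : List Sequence
spread = line (0ℙ , 0ℙ , 0ℙ , 1ℙ) (0ℙ , 0ℙ , 1ℙ , 0ℙ)
       ∷ line (0ℙ , 1ℙ , 0ℙ , 0ℙ) (1ℙ , 0ℙ , 1ℙ , 1ℙ)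
       ∷ line (0ℙ , 1ℙ , 0ℙ , 1ℙ) (1ℙ , 0ℙ , 0ℙ , 0ℙ)
       ∷ line (0ℙ , 1ℙ , 1ℙ , 0ℙ) (1ℙ , 0ℙ , 1ℙ , 0ℙ)
       ∷ line (0ℙ , 1ℙ , 1ℙ , 1ℙ) (1ℙ , 0ℙ , 0ℙ , 1ℙ)
       ∷ []

-- The seven images of the spread contain each of the 35 lines of PG(3,2)
-- exactly once (a solution of Kirkman's schoolgirl problem).
spreads : List (List Sequence)
spreads = iterate (map (map rotate)) spread 7

Shape : ℕ → ℕ → List Sequence → Set
Shape j m P = length P ≡ j × length (concat P) ≡ m

shape? : ∀ j m P → Dec (Shape j m P)
shape? j m P = (length P ≟ℕ j) ×-dec (length (concat P) ≟ℕ m)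

-- The `j` members of the packing use `m` terms; at least `b` terms remain and supply `k` more
-- subsequences.
complete : ∀ {j m k b n} P {R S} → All NonemptyZeroSum P → Shape j m P →
           Upper k b → m + b ≤ n → n ≤ length S → concat P ++ R ↭ S →
           HasDisjointZeroSums (j + k) S
complete P {R} zss (refl , refl) upper m+b≤n n≤|S| p =
  adjoins P zss p (upper R (remainder-length (concat P) p ≤-refl m+b≤n n≤|S|))

upper₀ : Upper 0 0
upper₀ S _ = none S

dot : V → V → Parity
dot (a , b , c , d) (a′ , b′ , c′ , d′) =
  (a *ℙ a′) +ℙ ((b *ℙ b′) +ℙ ((c *ℙ c′) +ℙ (d *ℙ d′)))

-- In lexicographic order, the two halves of an affine hyperplane are affine
-- planes, and these have sum zero.
halves : V → List Sequence
halves f = take 4 H ∷ drop 4 H ∷ []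
  where H = filter (λ x → dot f x Parity.≟ 1ℙ) elements

-- Abstract, so that checking the uses below does not expand the families.
abstract

  lines hyperplaneComplements partialSpreads fullSpreads : List (List Sequence)
  lines                 = map [_] (concat spreads)
  hyperplaneComplements = map halves (drop 1 elements)
  partialSpreads        = concatMap leaveOneOut spreads
  fullSpreads           = [ spread ]

  lines-packings : All Packing lines
  lines-packings = from-yes (All.all? packing? lines)

  lines-shape : All (Shape 1 3) lines
  lines-shape = from-yes (All.all? (shape? 1 3) lines)

  lines-cover : T (covers 5 (map concat lines))
  lines-cover = tt

  hyperplaneComplements-packings : All Packing hyperplaneComplements
  hyperplaneComplements-packings = from-yes (All.all? packing? hyperplaneComplements)

  hyperplaneComplements-shape : All (Shape 2 8) hyperplaneComplements
  hyperplaneComplements-shape = from-yes (All.all? (shape? 2 8) hyperplaneComplements)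

  lines-hyperplaneComplements-cover : T (covers 8 (map concat (lines ++ hyperplaneComplements)))
  lines-hyperplaneComplements-cover = tt

  partialSpreads-packings : All Packing partialSpreads
  partialSpreads-packings = from-yes (All.all? packing? partialSpreads)

  partialSpreads-shape : All (Shape 4 12) partialSpreads
  partialSpreads-shape = from-yes (All.all? (shape? 4 12) partialSpreads)

  partialSpreads-cover : T (covers 3 (map concat partialSpreads))
  partialSpreads-cover = tt

  fullSpreads-packings : All Packing fullSpreads
  fullSpreads-packings = from-yes (All.all? packing? fullSpreads)

  fullSpreads-shape : All (Shape 5 15) fullSpreads
  fullSpreads-shape = from-yes (All.all? (shape? 5 15) fullSpreads)

  fullSpreads-cover : T (covers 1 (map concat fullSpreads))
  fullSpreads-cover = tt

-- Upper bounds from packings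

upper₂ : Upper 2 8
-- `upper-suc` adds two to the length, but the bound grows by three, so 5 is relaxed to 6.
upper₂ = upper-suc (λ S → upper₁ S ∘ ≤-trans (n≤1+n 5)) simple
  where
  simple : ∀ S → length S ≥ 8 → Unique (ε ∷ S) → HasDisjointZeroSums 2 S
  simple S |S|≥8 u
    with P , R , P∈ , p ← find-packing 8 (lines ++ hyperplaneComplements) lines-hyperplaneComplements-cover
           (All.++⁺ lines-packings hyperplaneComplements-packings)
           (+-monoʳ-≤ 8 (s≤s |S|≥8)) u
    with ∈-++⁻ lines P∈
  ... | inj₁ P∈lines = complete P (proj₁ (All.lookup lines-packings P∈lines))
    (All.lookup lines-shape P∈lines) upper₁ ≤-refl |S|≥8 p
  ... | inj₂ P∈hyps = complete P (proj₁ (All.lookup hyperplaneComplements-packings P∈hyps))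
    (All.lookup hyperplaneComplements-shape P∈hyps) upper₀ ≤-refl |S|≥8 p

simple-upper : ∀ {j m k b l} n Ps → T (covers n (map concat Ps)) →
               All Packing Ps → All (Shape j m) Ps → Upper k b →
               m + b ≤ l → n + suc l > 16 →
               ∀ S → length S ≥ l → Unique (ε ∷ S) → HasDisjointZeroSums (j + k) S
simple-upper n Ps cover packings shape upper-k m+b≤l big S |S|≥l u
  with P , R , P∈ , p ← find-packing n Ps cover packings
         (≤-trans big (+-monoʳ-≤ n (s≤s |S|≥l))) u
  = complete P (proj₁ (All.lookup packings P∈)) (All.lookup shape P∈) upper-k m+b≤l |S|≥l p

upper₃ : Upper 3 11
upper₃ = upper-suc (λ S → upper₂ S ∘ ≤-trans (n≤1+n 8))
  (simple-upper 5 lines lines-cover lines-packings lines-shape upper₂ ≤-refl ≤-refl)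

upper₄ : Upper 4 13
upper₄ = upper-suc upper₃
  (simple-upper 3 partialSpreads partialSpreads-cover partialSpreads-packings
    -- Four lines use only twelve of the at least thirteen points.
    partialSpreads-shape upper₀ (n≤1+n 12) ≤-refl)

upper₅ : Upper 5 15
upper₅ = upper-suc upper₄
  (simple-upper 1 fullSpreads fullSpreads-cover fullSpreads-packings
    fullSpreads-shape upper₀ ≤-refl ≤-refl)

upper : ∀ m → Upper (3 + m) (5 + (3 + m) * 2)
upper 0 = upper₃
upper 1 = upper₄
upper 2 = upper₅
-- From k = 6 on, the length is at least 17, but there are only 15 nonzero elements, so the case of
-- a set is vacuous.
upper (suc (suc (suc m))) = upper-suc (upper (suc (suc m))) λ S |S|≥ u →
  contradiction (Unique⇒length≤16 u)
    (<⇒≱ (s≤s (≤-trans (m≤m+n 16 (suc (m * 2))) |S|≥)))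

-- Lower bounds

weight : V → ℕ
weight (_ , _ , _ , 0ℙ) = 2
weight (_ , _ , _ , 1ℙ) = 1

1≤weight : ∀ x → 1 ≤ weight x
1≤weight (_ , _ , _ , 0ℙ) = s≤s z≤n
1≤weight (_ , _ , _ , 1ℙ) = s≤s z≤n

totalWeight : Sequence → ℕ
totalWeight = sum ∘ map weight

totalWeight-++ : ∀ S S′ → totalWeight (S ++ S′) ≡ totalWeight S + totalWeight S′
totalWeight-++ S S′ = trans (cong sum (map-++ weight S S′)) (sum-++ (map weight S) (map weight S′))

Light : V → Set
Light x = weight x ≡ 1

-- Equal terms of weight 2 are allowed, because such a pair already has weight 4; the powers of `h`
-- rely on this.
Separated : V → V → Set
Separated x y = ¬ (x ≡ y × Light x)

separated? : ∀ x y → Dec (Separated x y)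
separated? x y = ¬? ((x ≟ y) ×-dec (weight x ≟ℕ 1))

Good : Sequence → Set
Good S = All (_≢ ε) S × AllPairs Separated S

good? : ∀ S → Dec (Good S)
good? S = All.all? (λ x → ¬? (x ≟ ε)) S ×-dec allPairs? separated? S

Good-↭ : ∀ {S S′} → S ↭ S′ → Good S → Good S′
Good-↭ p (nz , sep) = All-resp-↭ p nz ,
  SetoidPermutationProperties.AllPairs-resp-↭ (≡.setoid V)
    (λ s → λ { (refl , l) → s (refl , l) }) (resp₂ Separated) (↭⇒↭ₛ p) sep

Good-++⁻ : ∀ S {S′} → Good (S ++ S′) → Good S × Good S′
Good-++⁻ S (nz , sep) with nz₁ , nz₂ ← All.++⁻ S nz | sep₁ , sep₂ ← AllPairs-++⁻ S sep =
  (nz₁ , sep₁) , (nz₂ , sep₂)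

-- A single term would be zero. Two terms are equal, hence of weight 2 each. Three terms are not all
-- light, since their last coordinates sum to zero. Four terms have weight at least 4 anyway.
4≤totalWeight : ∀ S → Good S → NonemptyZeroSum S → 4 ≤ totalWeight S
4≤totalWeight [] _ (S≢[] , _) = contradiction refl S≢[]
4≤totalWeight (x ∷ []) (x≢ε ∷ [] , _) (_ , zs) =
  contradiction (trans (sym (≈⇒≡ (identityʳ x))) (≈⇒≡ zs)) x≢ε
4≤totalWeight (x ∷ y ∷ []) (_ , (sep ∷ []) ∷ _) (_ , zs)
  with refl ← ∙-injective x (trans (∙-self x) (trans (sym (≈⇒≡ zs)) (cong (x ∙_) (≈⇒≡ (identityʳ y)))))
  with x
... | _ , _ , _ , 0ℙ = ≤-refl
... | _ , _ , _ , 1ℙ = contradiction (refl , refl) sep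
4≤totalWeight ((_ , _ , _ , 0ℙ) ∷ y ∷ z ∷ []) _ _ =
  +-monoʳ-≤ 2 (+-mono-≤ (1≤weight y) (+-mono-≤ (1≤weight z) z≤n))
4≤totalWeight ((_ , _ , _ , 1ℙ) ∷ (_ , _ , _ , 0ℙ) ∷ z ∷ []) _ _ =
  +-monoʳ-≤ 3 (+-mono-≤ (1≤weight z) z≤n)
4≤totalWeight ((_ , _ , _ , 1ℙ) ∷ (_ , _ , _ , 1ℙ) ∷ (_ , _ , _ , 0ℙ) ∷ []) _ _ = ≤-refl
4≤totalWeight ((_ , _ , _ , 1ℙ) ∷ (_ , _ , _ , 1ℙ) ∷ (_ , _ , _ , 1ℙ) ∷ []) _ (_ , _ , _ , _ , ())
4≤totalWeight (x ∷ y ∷ z ∷ w ∷ S) _ _ =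
  +-mono-≤ (1≤weight x) (+-mono-≤ (1≤weight y) (+-mono-≤ (1≤weight z)
    (≤-trans (1≤weight w) (m≤m+n (weight w) (totalWeight S)))))

packing-weight : ∀ Ts → Good (concat Ts) → All NonemptyZeroSum Ts →
                 length Ts * 4 ≤ totalWeight (concat Ts)
packing-weight []       _ _ = z≤n
packing-weight (T ∷ Ts) good (zs ∷ zss) with goodT , goodTs ← Good-++⁻ T good =
  ≤-trans (+-mono-≤ (4≤totalWeight T goodT zs) (packing-weight Ts goodTs zss))
    (≤-reflexive (sym (totalWeight-++ T (concat Ts))))

σ-concat : ∀ {Ts} → All NonemptyZeroSum Ts → σ (concat Ts) ≡ ε
σ-concat []                        = refl
σ-concat {T ∷ Ts} ((_ , zs) ∷ zss) =
  trans (σ-++ T (concat Ts)) (cong₂ _∙_ (≈⇒≡ zs) (σ-concat zss))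

-- The `k` subsequences already have weight at least `k * 4`, which leaves weight 0 for the rest
-- `R`. As weights are positive, `R` is empty and `S` itself sums to zero.
no-packing : ∀ {k S} → Good S → totalWeight S ≤ k * 4 → σ S ≢ ε → ¬ HasDisjointZeroSums k S
no-packing {S = S} good light σ≢ε (Ts , refl , zss , R , perm) = exhausted R p heavy
  where
  p = ↭≈⇒↭ perm

  heavy : length Ts * 4 + totalWeight R ≤ length Ts * 4
  heavy = begin
    length Ts * 4 + totalWeight R
      ≤⟨ +-monoˡ-≤ (totalWeight R) (packing-weight Ts
           (proj₁ (Good-++⁻ (concat Ts) (Good-↭ (↭-sym p) good))) zss) ⟩
    totalWeight (concat Ts) + totalWeight R
      ≡⟨ totalWeight-++ (concat Ts) R ⟨
    totalWeight (concat Ts ++ R)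
      ≡⟨ sum-↭ (↭-map⁺ weight p) ⟩
    totalWeight S
      ≤⟨ light ⟩
    length Ts * 4 ∎
    where open ≤-Reasoning

  exhausted : ∀ R → concat Ts ++ R ↭ S → ¬ (length Ts * 4 + totalWeight R ≤ length Ts * 4)
  exhausted []      q _ = σ≢ε (trans (sym (σ-↭ q))
    (trans (cong σ (++-identityʳ (concat Ts))) (σ-concat zss)))
  exhausted (x ∷ R) _ h = contradiction
    (+-cancelˡ-≤ (length Ts * 4) _ 0 (≤-trans h (≤-reflexive (sym (+-identityʳ _)))))
    (<⇒≱ (≤-trans (1≤weight x) (m≤m+n (weight x) (totalWeight R))))

-- Extremal sequences and exact values

isD : ∀ {k} S → Upper k (suc (length S)) → ¬ HasDisjointZeroSums k S → IsD k (suc (length S))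
isD S upper-bound none-in-S =
  upper-bound , λ m upper-m → ≰⇒> (none-in-S ∘ upper-m S)

lightElements : Sequence
lightElements = filter (λ x → weight x ≟ℕ 1) elements

isD₁ : IsD 1 5
isD₁ = isD S upper₁ (no-packing (from-yes (good? S)) ≤-refl λ ())
  where S = (0ℙ , 0ℙ , 0ℙ , 1ℙ) ∷ (0ℙ , 0ℙ , 1ℙ , 1ℙ) ∷ (0ℙ , 1ℙ , 0ℙ , 1ℙ) ∷ (1ℙ , 0ℙ , 0ℙ , 1ℙ) ∷ []

isD₂ : IsD 2 8
isD₂ = isD S upper₂ (no-packing (from-yes (good? S)) (n≤1+n 7) λ ())
  -- All eight light elements sum to zero, so the sum of seven is the omitted one.
  where S = drop 1 lightElements

h h′ : V
h  = 1ℙ , 0ℙ , 0ℙ , 0ℙ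
h′ = 0ℙ , 1ℙ , 0ℙ , 0ℙ

-- At `m` = 0 the weight is 2 + 2 + 8 = 12, exactly 4k for k = 3. Each further pair `h`, `h` adds 2
-- to the length and 4 to the weight, and leaves the sum at `h ∙ h′`.
extremal : ℕ → Sequence
extremal zero    = h ∷ h′ ∷ lightElements
extremal (suc m) = h ∷ h ∷ extremal m

length-extremal : ∀ m → suc (length (extremal m)) ≡ 5 + (3 + m) * 2
length-extremal zero    = refl
length-extremal (suc m) = cong (2 +_) (length-extremal m)

extremal-good : ∀ m → Good (extremal m)
extremal-good zero = from-yes (good? (extremal 0))
extremal-good (suc m) with nz , sep ← extremal-good m =
  (λ ()) ∷ (λ ()) ∷ nz , separated _ ∷ separated _ ∷ sep
  where
  separated : ∀ S → All (Separated h) S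
  separated = All.universal λ _ ()

extremal-weight : ∀ m → totalWeight (extremal m) ≤ (3 + m) * 4
extremal-weight zero    = ≤-refl
extremal-weight (suc m) = +-monoʳ-≤ 4 (extremal-weight m)

σ-extremal : ∀ m → σ (extremal m) ≡ h ∙ h′
σ-extremal zero    = refl
σ-extremal (suc m) = trans (∙-cancel h (σ (extremal m))) (σ-extremal m)

isD₃₊ : ∀ m → IsD (3 + m) (5 + (3 + m) * 2)
isD₃₊ m = subst (IsD (3 + m)) (length-extremal m)
  (isD (extremal m) (subst (Upper (3 + m)) (sym (length-extremal m)) (upper m))
    (no-packing (extremal-good m) (extremal-weight m)
      λ σ≡ε → contradiction (trans (sym (σ-extremal m)) σ≡ε) λ ()))

-- The exponent and the linear range

isExponent : IsExponent 2
isExponent =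
  (s≤s z≤n , λ g → ≡⇒≈ (trans (cong (g ∙_) (≈⇒≡ (identityʳ g))) (∙-self g))) ,
  λ { zero (() , _) ; (suc zero) (_ , kills) → contradiction (proj₁ (kills h)) λ ()
    ; (suc (suc m)) _ → s≤s (s≤s z≤n) }

linearFrom₃ : LinearFrom 5 3
linearFrom₃ = s≤s z≤n , 2 , isExponent , λ { _ (s≤s (s≤s (s≤s {n = m} z≤n))) → isD₃₊ m }

-- Linearity already at k = 2 would force D_2 = 5 + 2 * 2 = 9, whereas the value is 8.
¬linearFrom₂ : ∀ {m} → m ≤ 2 → ¬ LinearFrom 5 m
¬linearFrom₂ m≤2 (_ , n , exponent , linear)
  with refl ← Least-unique exponent isExponent =
  contradiction (Least-unique (linear 2 m≤2) isD₂) λ ()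

theorem7p9 : (Davenport.IsD₀ C₂⁴ 5 × Davenport.IsK-D C₂⁴ 3) × (Davenport.IsD C₂⁴ 1 5 × Davenport.IsD C₂⁴ 2 8)
theorem7p9 =
  ((3 , linearFrom₃) ,
    5 , (3 , linearFrom₃) , linearFrom₃ , λ m linear → ≰⇒> λ m≤2 → ¬linearFrom₂ m≤2 linear) ,
  isD₁ , isD₂
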